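{- If $H$ is a forest (equivalently, a graph of degeneracy $1$), then $g(H,k)=\infty$ for all sufficiently large $k$.
   Context: For a graph $H$, an edge colouring $c:E(K_n)\to[k]$ contains a rainbow copy of $H$ if some subgraph of $K_n$ isomorphic to $H$ has all its edges of pairwise distinct colours; otherwise it is rainbow $H$-free. The colouring has colour distribution sequence $(e_1,\dots,e_k)$ if exactly $e_i$ edges have colour $i$. $g(H,k)$ is the smallest integer $N$ such that for all $n\ge N$ and all non-negative integers $e_1,\dots,e_k$ with $\sum_i e_i=\binom n2$, there exists a rainbow $H$-free colouring of $K_n$ with colour distribution sequence $(e_1,\dots,e_k)$; if no such $N$ exists, $g(H,k)=\infty$. A graph is $d$-degenerate if every subgraph has a vertex of degree at most $d$; the degeneracy is the smallest positive $d$ for which it is $d$-degenerate. -}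

module Defs where

open import Data.Nat using (ℕ; _+_; _<_; _≥_)
open import Data.Nat.Combinatorics using (_C_)
open import Data.Fin using (Fin; toℕ)
open import Data.Fin.Properties using (_≟_)
open import Data.Fin using (_<?_)
open import Data.List using (List; length; filter; map; concatMap; allFin)
open import Data.Nat.ListAction using (sum)
open import Data.Product using (_×_; _,_; Σ; ∃; ∃-syntax)
open import Data.Sum using (_⊎_)
open import Relation.Nullary using (¬_)
open import Relation.Binary.PropositionalEquality using (_≡_; _≢_)
open import Function.Definitions using (Injective)

record Graph (m : ℕ) : Set₁ where
  field
    Adj   : Fin m → Fin m → Set
    sym   : ∀ {u v} → Adj u v → Adj v u
    irref : ∀ {u} → ¬ Adj u u
open Graph public

record Cycle {m : ℕ} (H : Graph m) : Set where
  field
    len     : ℕ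
    w       : Fin (3 + len) → Fin m
    w-inj   : Injective _≡_ _≡_ w
    w-adj   : ∀ (i j : Fin (3 + len)) → toℕ j ≡ 1 + toℕ i → Adj H (w i) (w j)
    w-close : ∀ (i j : Fin (3 + len)) → toℕ i ≡ 2 + len → toℕ j ≡ 0 → Adj H (w i) (w j)

Forest : ∀ {m} → Graph m → Set
Forest H = ¬ Cycle H

-- An edge colouring of K_n with k colours: a symmetric map (diagonal values are irrelevant).
record Colouring (n k : ℕ) : Set where
  field
    col  : Fin n → Fin n → Fin k
    csym : ∀ x y → col x y ≡ col y x
open Colouring public

edgesK : (n : ℕ) → List (Fin n × Fin n)
edgesK n = concatMap (λ x → map (λ y → x , y) (filter (λ y → x <? y) (allFin n))) (allFin n)

colourCount : ∀ {n k} → Colouring n k → Fin k → ℕ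
colourCount {n} c i = length (filter (λ p → col c (Data.Product.proj₁ p) (Data.Product.proj₂ p) ≟ i) (edgesK n))

HasDistribution : ∀ {n k} → Colouring n k → (Fin k → ℕ) → Set
HasDistribution c e = ∀ i → colourCount c i ≡ e i

RainbowCopy : ∀ {m n k} → Graph m → Colouring n k → Set
RainbowCopy {m} {n} H c =
  Σ (Fin m → Fin n) λ φ → Injective _≡_ _≡_ φ ×
    (∀ u v u' v' → Adj H u v → Adj H u' v' →
       col c (φ u) (φ v) ≡ col c (φ u') (φ v') →
       (u ≡ u' × v ≡ v') ⊎ (u ≡ v' × v ≡ u'))

RainbowFree : ∀ {m n k} → Graph m → Colouring n k → Set
RainbowFree H c = ¬ RainbowCopy H c

-- N witnesses that g(H,k) ≤ N.
GBound : ∀ {m} → Graph m → ℕ → ℕ → Set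
GBound H k N = ∀ n → n ≥ N → (e : Fin k → ℕ) → sum (map e (allFin k)) ≡ n C 2 →
  Σ (Colouring n k) λ c → HasDistribution c e × RainbowFree H c

GInfinite : ∀ {m} → Graph m → ℕ → Set
GInfinite H k = ¬ (∃[ N ] GBound H k N)

{-# OPTIONS --safe #-}
-- Colour K_n with k > m⁴ colours, each used equally often.  Put A₀ = V(K_n) and
-- let A_{d+1} be the set of vertices joined to A_d by at least m colours, each
-- on at least m edges; these sets decrease.  If A_m contains a vertex, H embeds
-- greedily: add its vertices in reverse order of leaf removal, placing the s-th
-- one in A_{m-s}, so that each placed vertex still offers an unused colour
-- leading to an unused vertex one level below.
-- If A_m is empty, the m sets A_d \ A_{d+1} cover V(K_n), so one of them, L, has
-- at least n/m vertices, and each x in L sees fewer than m colours within L,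
-- up to O(k) edges.  Counting triples x, y, z in L with xy and xz of the same
-- colour gives at least about |L|³/m of them by Cauchy-Schwarz.  On the other
-- hand a colour i frequent at |P_i| vertices of L has degree about |P_i| at most
-- in L, and Σ |P_i| ≤ m |L|, so there are at most about m |L| n²/k triples.
-- Together these give k ≤ m⁴ once n is large.
module Submission where

open import Defs renaming (sym to adj-sym)
open import Data.Nat hiding (_≟_)
open import Data.Nat.Properties hiding (_≟_)
open import Data.Nat.Combinatorics using (_C_; nC1≡n; nCk+nC[k+1]≡[n+1]C[k+1])
open import Data.Nat.Induction using (<-rec)
import Data.Nat.ListAction as ListAction
open import Data.Nat.Tactic.RingSolver using (solve-∀)
open import Data.Bool using (Bool; true; false; T; _∧_; not)
open import Data.Bool.Properties using (T-∧)
open import Data.Fin as Fin using (Fin; zero; suc; toℕ)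
open import Data.Fin.Properties as Finₚ using (_≟_; any?; pigeonhole; toℕ<n; toℕ-injective)
open import Data.List using (List; []; _∷_; length; filter; map; concatMap; tabulate; allFin)
open import Data.List.Properties using (filter-++; length-++; length-tabulate; length-map; filter-notAll)
open import Data.List.Membership.Propositional using (_∈_; _∉_; find; lose)
open import Data.List.Membership.Propositional.Properties using (∈-map⁺; ∈-filter⁺; ∈-filter⁻; ∈-allFin)
open import Data.List.Membership.DecPropositional using (_∈?_)
open import Data.List.Relation.Unary.All as All using ()
open import Data.List.Relation.Unary.Any as Any using (here; there)
open import Data.Product using (_×_; _,_; ∃-syntax; proj₁; proj₂)
open import Data.Sum using (_⊎_; inj₁; inj₂)
open import Function using (_∘_; id; Equivalence)
open import Relation.Nullary using (Dec; yes; no; ¬_; contradiction)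
open import Relation.Nullary.Decidable using (⌊_⌋; map′; _×-dec_; _→-dec_; ¬?; T?; toWitness; decidable-stable; ¬¬-excluded-middle)
open import Relation.Unary using (Decidable)
open import Relation.Binary.Definitions using (tri<; tri≈; tri>)
open import Relation.Binary.PropositionalEquality using (_≡_; _≢_; refl; sym; trans; cong; cong₂; subst)
open import Algebra.Properties.Semiring.Sum +-*-semiring using (∑-distrib-+; ∑-comm; *-distribˡ-sum; *-distribʳ-sum; sum-cong-≗; sum-syntax) renaming (sum to ∑)

-- Sums over `Fin n`, and the triple count inside a vertex set

∑-mono-≤ : ∀ {n} {f g : Fin n → ℕ} → (∀ i → f i ≤ g i) → ∑ f ≤ ∑ g
∑-mono-≤ {zero}  f≤g = z≤n
∑-mono-≤ {suc n} f≤g = +-mono-≤ (f≤g zero) (∑-mono-≤ (f≤g ∘ suc))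

∑-const : ∀ n c → ∑[ i < n ] c ≡ n * c
∑-const zero    c = refl
∑-const (suc n) c = cong (c +_) (∑-const n c)

2uv≤u²+v² : ∀ u v → 2 * (u * v) ≤ u * u + v * v
2uv≤u²+v² u v with ≤-total u v
... | inj₁ u≤v with w , refl ← m≤n⇒∃[o]m+o≡n u≤v =
  subst (2 * (u * v) ≤_) (identity u w) (m≤m+n _ (w * w))
  where identity : ∀ u w → 2 * (u * (u + w)) + w * w ≡ u * u + (u + w) * (u + w)
        identity = solve-∀
... | inj₂ v≤u with w , refl ← m≤n⇒∃[o]m+o≡n v≤u =
  subst (2 * (u * v) ≤_) (identity v w) (m≤m+n _ (w * w))
  where identity : ∀ v w → 2 * ((v + w) * v) + w * w ≡ (v + w) * (v + w) + v * v
        identity = solve-∀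

-- l is the indicator of a vertex set L, e x y that of the colour of xy, d x i
-- the number of i-coloured edges from x into L, and f x i marks the colours
-- that are frequent at x.  Both bounds below are on Σₓ Σᵢ (d x i)² over x in L.
module LocalColouring
  {n k : ℕ} (t M : ℕ) .{{_ : NonZero t}}
  (l : Fin n → ℕ) (e : Fin n → Fin n → Fin k → ℕ) (f : Fin n → Fin k → ℕ)
  (l-01 : ∀ x → l x ≡ 0 ⊎ l x ≡ 1)
  (e-total : ∀ x y → ∑ (e x y) ≡ 1)
  (e≤1 : ∀ x y i → e x y i ≤ 1)
  (e-sym : ∀ x y i → e x y i ≡ e y x i)
  where

  d : Fin n → Fin k → ℕ
  d x i = ∑[ y < n ] (l y * e x y i)

  a : ℕ
  a = ∑ l

  module _
    (f-01 : ∀ x i → f x i ≡ 1 ⊎ (f x i ≡ 0 × d x i ≤ t))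
    (f-few : ∀ x → l x ≡ 1 → ∑ (f x) ≤ t)
    (colour-few : ∀ i → ∑[ x < n ] (l x * d x i) ≤ M)
    where

    open ≤-Reasoning

    ∑d≡a : ∀ x → ∑ (d x) ≡ a
    ∑d≡a x = begin-equality
      ∑[ i < k ] ∑[ y < n ] (l y * e x y i) ≡⟨ ∑-comm (λ i y → l y * e x y i) ⟩
      ∑[ y < n ] ∑[ i < k ] (l y * e x y i) ≡⟨ sum-cong-≗ (λ y → sym (*-distribˡ-sum (l y) (e x y))) ⟩
      ∑[ y < n ] (l y * ∑ (e x y))          ≡⟨ sum-cong-≗ (λ y → trans (cong (l y *_) (e-total x y)) (*-identityʳ (l y))) ⟩
      a ∎

    S : Fin n → ℕ
    S x = ∑[ i < k ] (d x i * d x i)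

    -- A frequent colour is handled by `2uv≤u²+v²` with u = t * d and v = a, a linearised form of
    -- Cauchy-Schwarz that avoids division; a rare colour has d ≤ t, and the last summand absorbs
    -- it.
    lower-pointwise : ∀ x i →
      2 * (t * a) * d x i ≤ t * t * (d x i * d x i) + f x i * (a * a) + 2 * (t * t * a)
    lower-pointwise x i with f-01 x i
    ... | inj₁ f≡1 rewrite f≡1 = begin
      2 * (t * a) * d x i                        ≡⟨ regroup t a (d x i) ⟩
      2 * (t * d x i * a)                        ≤⟨ 2uv≤u²+v² (t * d x i) a ⟩
      t * d x i * (t * d x i) + a * a            ≡⟨ square t a (d x i) ⟩
      t * t * (d x i * d x i) + 1 * (a * a)      ≤⟨ m≤m+n _ _ ⟩
      t * t * (d x i * d x i) + 1 * (a * a) + 2 * (t * t * a) ∎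
      where regroup : ∀ t a d → 2 * (t * a) * d ≡ 2 * (t * d * a)
            regroup = solve-∀
            square : ∀ t a d → t * d * (t * d) + a * a ≡ t * t * (d * d) + 1 * (a * a)
            square = solve-∀
    ... | inj₂ (_ , d≤t) = begin
      2 * (t * a) * d x i  ≤⟨ *-monoʳ-≤ (2 * (t * a)) d≤t ⟩
      2 * (t * a) * t      ≡⟨ identity t a ⟩
      2 * (t * t * a)      ≤⟨ m≤n+m _ (t * t * (d x i * d x i) + f x i * (a * a)) ⟩
      t * t * (d x i * d x i) + f x i * (a * a) + 2 * (t * t * a) ∎
      where identity : ∀ t a → 2 * (t * a) * t ≡ 2 * (t * t * a)
            identity = solve-∀

    -- Summing `lower-pointwise` over the colours turns the left side into 2ta², since the degrees
    -- add up to `a`. The at most `t` frequent colours give back ta², and cancelling this leaves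
    -- `S x` of order at least a²/t.
    lower : ∀ x → l x ≡ 1 → a * a ≤ t * S x + 2 * (t * k * a)
    lower x lx = *-cancelˡ-≤ t (+-cancelˡ-≤ (t * (a * a)) _ _ (begin
      t * (a * a) + t * (a * a)  ≡⟨ double t a ⟩
      2 * (t * a) * a            ≡⟨ cong (2 * (t * a) *_) (∑d≡a x) ⟨
      2 * (t * a) * ∑ (d x)      ≡⟨ *-distribˡ-sum (2 * (t * a)) (d x) ⟩
      ∑[ i < k ] (2 * (t * a) * d x i) ≤⟨ ∑-mono-≤ (lower-pointwise x) ⟩
      ∑[ i < k ] (t * t * (d x i * d x i) + f x i * (a * a) + 2 * (t * t * a))
        ≡⟨ trans (∑-distrib-+ (λ i → t * t * (d x i * d x i) + f x i * (a * a)) (λ _ → 2 * (t * t * a)))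
                 (cong₂ _+_ (∑-distrib-+ (λ i → t * t * (d x i * d x i)) (λ i → f x i * (a * a))) (∑-const k _)) ⟩
      ∑[ i < k ] (t * t * (d x i * d x i)) + ∑[ i < k ] (f x i * (a * a)) + k * (2 * (t * t * a))
        ≡⟨ cong (_+ k * (2 * (t * t * a)))
             (cong₂ _+_ (*-distribˡ-sum (t * t) (λ i → d x i * d x i)) (*-distribʳ-sum (a * a) (f x))) ⟨
      t * t * S x + ∑ (f x) * (a * a) + k * (2 * (t * t * a))
        ≤⟨ +-monoˡ-≤ _ (+-monoʳ-≤ (t * t * S x) (*-monoˡ-≤ (a * a) (f-few x lx))) ⟩
      t * t * S x + t * (a * a) + k * (2 * (t * t * a)) ≡⟨ collect t k a (S x) ⟩
      t * (a * a) + t * (t * S x + 2 * (t * k * a)) ∎))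
      where double : ∀ t a → t * (a * a) + t * (a * a) ≡ 2 * (t * a) * a
            double = solve-∀
            collect : ∀ t k a s → t * t * s + t * (a * a) + k * (2 * (t * t * a)) ≡ t * (a * a) + t * (t * s + 2 * (t * k * a))
            collect = solve-∀

    d≤a : ∀ x i → d x i ≤ a
    d≤a x i = ∑-mono-≤ (λ y → ≤-trans (*-monoʳ-≤ (l y) (e≤1 x y i)) (≤-reflexive (*-identityʳ (l y))))

    P : Fin k → ℕ
    P i = ∑[ y < n ] (l y * f y i)

    g : Fin n → Fin k → ℕ
    g y i = 1 ∸ f y i

    -- An edge is charged to its end `y`: if `i` is frequent at `y`, then `y` pays even when `xy`
    -- has another colour; otherwise the edge itself is kept.
    e-split : ∀ x y i → l y * e x y i ≤ l y * f y i + l y * g y i * e x y i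
    e-split x y i with f-01 y i
    ... | inj₁ f≡1 rewrite f≡1 = ≤-trans (*-monoʳ-≤ (l y) (e≤1 x y i)) (m≤m+n _ _)
    ... | inj₂ (f≡0 , _) rewrite f≡0 | *-identityʳ (l y) = m≤n+m _ _

    gd≤t : ∀ y i → g y i * d y i ≤ t
    gd≤t y i with f-01 y i
    ... | inj₁ f≡1 rewrite f≡1 = z≤n
    ... | inj₂ (f≡0 , d≤t) rewrite f≡0 | +-identityʳ (d y i) = d≤t

    -- One of the two factors `d x i` is split by `e-split`. Its frequent part is the same number
    -- `P i` for every `x`, and the other factor then sums to at most `M`; against the rare part the
    -- other factor is bounded by `a`.
    upper-colour : ∀ i → ∑[ x < n ] (l x * (d x i * d x i)) ≤ M * P i + a * (a * t)
    upper-colour i = begin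
      ∑[ x < n ] (l x * (d x i * d x i)) ≤⟨ ∑-mono-≤ pointwise ⟩
      ∑[ x < n ] (l x * d x i * P i + a * ∑[ y < n ] (l x * (l y * g y i * e x y i)))
        ≡⟨ trans (∑-distrib-+ (λ x → l x * d x i * P i) (λ x → a * ∑[ y < n ] (l x * (l y * g y i * e x y i))))
             (cong₂ _+_ (sym (*-distribʳ-sum (P i) (λ x → l x * d x i)))
                        (sym (*-distribˡ-sum a (λ x → ∑[ y < n ] (l x * (l y * g y i * e x y i)))))) ⟩
      ∑[ x < n ] (l x * d x i) * P i + a * ∑[ x < n ] ∑[ y < n ] (l x * (l y * g y i * e x y i))
        ≤⟨ +-mono-≤ (*-monoˡ-≤ (P i) (colour-few i)) (*-monoʳ-≤ a rare) ⟩
      M * P i + a * (a * t) ∎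
      where
      pointwise : ∀ x → l x * (d x i * d x i) ≤ l x * d x i * P i + a * ∑[ y < n ] (l x * (l y * g y i * e x y i))
      pointwise x = begin
        l x * (d x i * d x i)
          ≤⟨ *-monoʳ-≤ (l x) (*-monoʳ-≤ (d x i) (∑-mono-≤ (λ y → e-split x y i))) ⟩
        l x * (d x i * ∑[ y < n ] (l y * f y i + l y * g y i * e x y i))
          ≡⟨ cong (λ z → l x * (d x i * z)) (∑-distrib-+ (λ y → l y * f y i) (λ y → l y * g y i * e x y i)) ⟩
        l x * (d x i * (P i + R))
          ≡⟨ expand (l x) (d x i) (P i) R ⟩
        l x * d x i * P i + d x i * (l x * R)
          ≤⟨ +-monoʳ-≤ (l x * d x i * P i) (*-monoˡ-≤ (l x * R) (d≤a x i)) ⟩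
        l x * d x i * P i + a * (l x * R)
          ≡⟨ cong (λ z → l x * d x i * P i + a * z) (*-distribˡ-sum (l x) (λ y → l y * g y i * e x y i)) ⟩
        l x * d x i * P i + a * ∑[ y < n ] (l x * (l y * g y i * e x y i)) ∎
        where
        R : ℕ
        R = ∑[ y < n ] (l y * g y i * e x y i)
        expand : ∀ u v p r → u * (v * (p + r)) ≡ u * v * p + v * (u * r)
        expand = solve-∀

      -- Symmetry lets these edges be counted from `y`, where `i` is rare, so each `y` in L
      -- contributes at most `t`.
      rare : ∑[ x < n ] ∑[ y < n ] (l x * (l y * g y i * e x y i)) ≤ a * t
      rare = begin
        ∑[ x < n ] ∑[ y < n ] (l x * (l y * g y i * e x y i))
          ≡⟨ ∑-comm (λ x y → l x * (l y * g y i * e x y i)) ⟩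
        ∑[ y < n ] ∑[ x < n ] (l x * (l y * g y i * e x y i))
          ≡⟨ sum-cong-≗ (λ y → trans (sum-cong-≗ (λ x → trans (cong (λ z → l x * (l y * g y i * z)) (e-sym x y i)) (reorder (l x) (l y) (g y i) (e y x i))))
                                     (sym (*-distribˡ-sum (l y * g y i) (λ x → l x * e y x i)))) ⟩
        ∑[ y < n ] (l y * g y i * d y i)
          ≤⟨ ∑-mono-≤ (λ y → ≤-trans (≤-reflexive (*-assoc (l y) (g y i) (d y i))) (*-monoʳ-≤ (l y) (gd≤t y i))) ⟩
        ∑[ y < n ] (l y * t) ≡⟨ *-distribʳ-sum t l ⟨
        a * t ∎
        where
        reorder : ∀ u v w z → u * (v * w * z) ≡ v * w * (u * z)
        reorder = solve-∀

    ∑P≤ta : ∑ P ≤ a * t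
    ∑P≤ta = begin
      ∑[ i < k ] ∑[ y < n ] (l y * f y i) ≡⟨ ∑-comm (λ i y → l y * f y i) ⟩
      ∑[ y < n ] ∑[ i < k ] (l y * f y i) ≡⟨ sum-cong-≗ (λ y → sym (*-distribˡ-sum (l y) (f y))) ⟩
      ∑[ y < n ] (l y * ∑ (f y))          ≤⟨ ∑-mono-≤ pointwise ⟩
      ∑[ y < n ] (l y * t)                ≡⟨ *-distribʳ-sum t l ⟨
      a * t ∎
      where
      pointwise : ∀ y → l y * ∑ (f y) ≤ l y * t
      pointwise y with l-01 y
      ... | inj₁ ly≡0 rewrite ly≡0 = z≤n
      ... | inj₂ ly≡1 = *-monoʳ-≤ (l y) (f-few y ly≡1)

    upper : ∑[ x < n ] (l x * S x) ≤ M * (a * t) + k * (a * (a * t))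
    upper = begin
      ∑[ x < n ] (l x * S x)
        ≡⟨ sum-cong-≗ (λ x → *-distribˡ-sum (l x) (λ i → d x i * d x i)) ⟩
      ∑[ x < n ] ∑[ i < k ] (l x * (d x i * d x i)) ≡⟨ ∑-comm (λ x i → l x * (d x i * d x i)) ⟩
      ∑[ i < k ] ∑[ x < n ] (l x * (d x i * d x i)) ≤⟨ ∑-mono-≤ upper-colour ⟩
      ∑[ i < k ] (M * P i + a * (a * t))
        ≡⟨ trans (∑-distrib-+ (λ i → M * P i) (λ _ → a * (a * t))) (cong₂ _+_ (sym (*-distribˡ-sum M P)) (∑-const k _)) ⟩
      M * ∑ P + k * (a * (a * t)) ≤⟨ +-monoˡ-≤ _ (*-monoʳ-≤ M ∑P≤ta) ⟩
      M * (a * t) + k * (a * (a * t)) ∎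

    -- `lower` summed over L meets `upper`, and a common factor `a` cancels once a = 0 is split off.
    -- With `M` about n²/k the main term is t²n²/k.
    a²-bound : a * a ≤ t * t * M + (t * t + 2 * t) * k * a
    a²-bound with m≤n⇒m<n∨m≡n (z≤n {a})
    ... | inj₂ 0≡a rewrite sym 0≡a = z≤n
    ... | inj₁ 0<a = *-cancelˡ-≤ a {{>-nonZero 0<a}} (begin
      a * (a * a)            ≡⟨ *-distribʳ-sum (a * a) l ⟩
      ∑[ x < n ] (l x * (a * a)) ≤⟨ ∑-mono-≤ pointwise ⟩
      ∑[ x < n ] (t * (l x * S x) + l x * (2 * (t * k * a)))
        ≡⟨ trans (∑-distrib-+ (λ x → t * (l x * S x)) (λ x → l x * (2 * (t * k * a))))
                 (cong₂ _+_ (sym (*-distribˡ-sum t (λ x → l x * S x))) (sym (*-distribʳ-sum (2 * (t * k * a)) l))) ⟩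
      t * ∑[ x < n ] (l x * S x) + a * (2 * (t * k * a)) ≤⟨ +-monoˡ-≤ _ (*-monoʳ-≤ t upper) ⟩
      t * (M * (a * t) + k * (a * (a * t))) + a * (2 * (t * k * a)) ≡⟨ collect t M k a ⟩
      a * (t * t * M + (t * t + 2 * t) * k * a) ∎)
      where
      collect : ∀ t M k a → t * (M * (a * t) + k * (a * (a * t))) + a * (2 * (t * k * a)) ≡ a * (t * t * M + (t * t + 2 * t) * k * a)
      collect = solve-∀
      pointwise : ∀ x → l x * (a * a) ≤ t * (l x * S x) + l x * (2 * (t * k * a))
      pointwise x with l-01 x
      ... | inj₁ lx≡0 rewrite lx≡0 = z≤n
      ... | inj₂ lx≡1 = begin
        l x * (a * a) ≤⟨ *-monoʳ-≤ (l x) (lower x lx≡1) ⟩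
        l x * (t * S x + 2 * (t * k * a)) ≡⟨ distribute (l x) t (S x) (2 * (t * k * a)) ⟩
        t * (l x * S x) + l x * (2 * (t * k * a)) ∎
        where
        distribute : ∀ u t s z → u * (t * s + z) ≡ t * (u * s) + u * z
        distribute = solve-∀

-- Counting with indicators

𝟙 : Bool → ℕ
𝟙 true  = 1
𝟙 false = 0

𝟙≤1 : ∀ b → 𝟙 b ≤ 1
𝟙≤1 true  = ≤-refl
𝟙≤1 false = z≤n

𝟙-01 : ∀ b → 𝟙 b ≡ 0 ⊎ 𝟙 b ≡ 1
𝟙-01 true  = inj₂ refl
𝟙-01 false = inj₁ refl

𝟙-mono : ∀ {b c} → (T b → T c) → 𝟙 b ≤ 𝟙 c
𝟙-mono {false}         _ = z≤n
𝟙-mono {true}  {true}  _ = ≤-refl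
𝟙-mono {true}  {false} h = contradiction _ h

𝟙-∧ : ∀ b c → 𝟙 (b ∧ c) ≡ 𝟙 b * 𝟙 c
𝟙-∧ true  c = sym (+-identityʳ (𝟙 c))
𝟙-∧ false c = refl

count : ∀ {n} → (Fin n → Bool) → ℕ
count P = ∑ (𝟙 ∘ P)

count-mono : ∀ {n} {P Q : Fin n → Bool} → (∀ x → T (P x) → T (Q x)) → count P ≤ count Q
count-mono P⇒Q = ∑-mono-≤ (λ x → 𝟙-mono (P⇒Q x))

𝟙≡ : ∀ {n} → Fin n → Fin n → ℕ
𝟙≡ i j = 𝟙 ⌊ i ≟ j ⌋

𝟙≡-refl : ∀ {n} (i : Fin n) → 𝟙≡ i i ≡ 1
𝟙≡-refl i with i ≟ i
... | yes _  = refl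
... | no i≢i = contradiction refl i≢i

∑-𝟙≡ : ∀ {n} (j : Fin n) → ∑ (𝟙≡ j) ≡ 1
∑-𝟙≡ {suc n} zero    = cong suc (trans (∑-const n 0) (*-zeroʳ n))
∑-𝟙≡ {suc n} (suc j) = trans (sum-cong-≗ pointwise) (∑-𝟙≡ j)
  where
  pointwise : ∀ i → 𝟙≡ (suc j) (suc i) ≡ 𝟙≡ j i
  pointwise i with j ≟ i
  ... | yes _ = refl
  ... | no  _ = refl

-- Otherwise the indicator of `P` lies below the multiplicity function `occ xs`, whose sum is the
-- length of `xs` even if `xs` has repetitions.
count>length⇒∃∉ : ∀ {n} (P : Fin n → Bool) (xs : List (Fin n)) → length xs < count P → ∃[ x ] T (P x) × x ∉ xs
count>length⇒∃∉ {n} P xs len<count with any? (λ x → T? (P x) ×-dec ¬? (_∈?_ _≟_ x xs))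
... | yes found = found
... | no none = contradiction len<count (≤⇒≯ (≤-trans (∑-mono-≤ covered) (≤-reflexive (∑-occ xs))))
  where
  occ : List (Fin n) → Fin n → ℕ
  occ []       x = 0
  occ (y ∷ ys) x = 𝟙≡ y x + occ ys x

  ∑-occ : ∀ ys → ∑ (occ ys) ≡ length ys
  ∑-occ []       = trans (∑-const n 0) (*-zeroʳ n)
  ∑-occ (y ∷ ys) = trans (∑-distrib-+ (𝟙≡ y) (occ ys)) (cong₂ _+_ (∑-𝟙≡ y) (∑-occ ys))

  ∈⇒occ : ∀ {x} ys → x ∈ ys → 1 ≤ occ ys x
  ∈⇒occ {x} (y ∷ ys) (here refl) rewrite 𝟙≡-refl x = s≤s z≤n
  ∈⇒occ {x} (y ∷ ys) (there x∈ys) = ≤-trans (∈⇒occ ys x∈ys) (m≤n+m _ (𝟙≡ y x))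

  covered : ∀ x → 𝟙 (P x) ≤ occ xs x
  covered x with P x in eq | _∈?_ _≟_ x xs
  ... | false | _        = z≤n
  ... | true  | yes x∈xs = ∈⇒occ xs x∈xs
  ... | true  | no  x∉xs = contradiction (x , subst T (sym eq) _ , x∉xs) none

-- Sizes of colour classes and the number of edges

module _ {A : Set} {P : A → Set} (P? : Decidable P) where

  length-filter-concatMap-tabulate : ∀ {B : Set} {n} (g : B → List A) (f : Fin n → B) →
    length (filter P? (concatMap g (tabulate f))) ≡ ∑[ i < n ] length (filter P? (g (f i)))
  length-filter-concatMap-tabulate {n = zero}  g f = refl
  length-filter-concatMap-tabulate {n = suc n} g f = trans
    (cong length (filter-++ P? (g (f zero)) _))
    (trans (length-++ (filter P? (g (f zero))))
           (cong (length (filter P? (g (f zero))) +_) (length-filter-concatMap-tabulate g (f ∘ suc))))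

  length-filter-map-filter : ∀ {B : Set} {Q : B → Set} (Q? : Decidable Q) {n} (g : B → A) (f : Fin n → B) →
    length (filter P? (map g (filter Q? (tabulate f)))) ≡ ∑[ i < n ] (𝟙 ⌊ Q? (f i) ⌋ * 𝟙 ⌊ P? (g (f i)) ⌋)
  length-filter-map-filter Q? {zero}  g f = refl
  length-filter-map-filter Q? {suc n} g f with Q? (f zero)
  ... | no  _ = length-filter-map-filter Q? g (f ∘ suc)
  ... | yes _ with P? (g (f zero))
  ...   | yes _ = cong suc (length-filter-map-filter Q? g (f ∘ suc))
  ...   | no  _ = length-filter-map-filter Q? g (f ∘ suc)

module _ {n k : ℕ} (c : Colouring n k) where

  colourCount≡∑ : ∀ i → colourCount c i ≡ ∑[ x < n ] ∑[ y < n ] (𝟙 ⌊ x Fin.<? y ⌋ * 𝟙≡ (col c x y) i)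
  colourCount≡∑ i = trans
    (length-filter-concatMap-tabulate (λ p → col c (proj₁ p) (proj₂ p) ≟ i) (λ x → map (x ,_) (filter (x Fin.<?_) (allFin n))) id)
    (sum-cong-≗ (λ x → length-filter-map-filter (λ p → col c (proj₁ p) (proj₂ p) ≟ i) (x Fin.<?_) (x ,_) id))

  -- The summand n accounts for the diagonal, on which col is arbitrary.
  ∑∑-colour≤ : ∀ i → ∑[ x < n ] ∑[ y < n ] 𝟙≡ (col c x y) i ≤ 2 * colourCount c i + n
  ∑∑-colour≤ i = begin
    ∑[ x < n ] ∑[ y < n ] 𝟙≡ (col c x y) i
      ≤⟨ ∑-mono-≤ (λ x → ∑-mono-≤ (pointwise x)) ⟩
    ∑[ x < n ] ∑[ y < n ] (up x y + up y x + 𝟙≡ x y)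
      ≡⟨ sum-cong-≗ (λ x → trans (∑-distrib-+ (λ y → up x y + up y x) (𝟙≡ x))
                                 (cong₂ _+_ (∑-distrib-+ (up x) (λ y → up y x)) (∑-𝟙≡ x))) ⟩
    ∑[ x < n ] (∑ (up x) + ∑[ y < n ] up y x + 1)
      ≡⟨ trans (∑-distrib-+ (λ x → ∑ (up x) + ∑[ y < n ] up y x) (λ _ → 1))
               (cong₂ _+_ (∑-distrib-+ (λ x → ∑ (up x)) (λ x → ∑[ y < n ] up y x)) (trans (∑-const n 1) (*-identityʳ n))) ⟩
    ∑[ x < n ] ∑ (up x) + ∑[ x < n ] ∑[ y < n ] up y x + n
      ≡⟨ cong (λ z → ∑[ x < n ] ∑ (up x) + z + n) (∑-comm (λ x y → up y x)) ⟩
    ∑[ x < n ] ∑ (up x) + ∑[ x < n ] ∑ (up x) + n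
      ≡⟨ cong (_+ n) (trans (cong (s +_) (sym (+-identityʳ s))) (cong (2 *_) (sym (colourCount≡∑ i)))) ⟩
    2 * colourCount c i + n ∎
    where
    open ≤-Reasoning
    up : Fin n → Fin n → ℕ
    up x y = 𝟙 ⌊ x Fin.<? y ⌋ * 𝟙≡ (col c x y) i
    s : ℕ
    s = ∑[ x < n ] ∑ (up x)
    up-< : ∀ x y → x Fin.< y → 𝟙≡ (col c x y) i ≤ up x y
    up-< x y x<y with x Fin.<? y
    ... | yes _  = ≤-reflexive (sym (+-identityʳ _))
    ... | no x≮y = contradiction x<y x≮y
    pointwise : ∀ x y → 𝟙≡ (col c x y) i ≤ up x y + up y x + 𝟙≡ x y
    pointwise x y with Finₚ.<-cmp x y
    ... | tri< x<y _ _ = ≤-trans (up-< x y x<y) (≤-trans (m≤m+n _ (up y x)) (m≤m+n _ (𝟙≡ x y)))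
    ... | tri≈ _ refl _ = ≤-trans (𝟙≤1 _) (≤-trans (≤-reflexive (sym (𝟙≡-refl x))) (m≤n+m _ (up x x + up x x)))
    ... | tri> _ _ y<x rewrite csym c x y = ≤-trans (up-< y x y<x) (≤-trans (m≤n+m _ (𝟙 ⌊ x Fin.<? y ⌋ * 𝟙≡ (col c y x) i)) (m≤m+n _ (𝟙≡ x y)))

2*nC2+n≡n*n : ∀ n → 2 * (n C 2) + n ≡ n * n
2*nC2+n≡n*n zero    = refl
2*nC2+n≡n*n (suc n) = trans
  (cong (λ z → 2 * z + suc n) (trans (sym (nCk+nC[k+1]≡[n+1]C[k+1] n 1)) (cong (_+ n C 2) (nC1≡n n))))
  (trans (step₁ n (n C 2)) (trans (cong (_+ (2 * n + 1)) (2*nC2+n≡n*n n)) (step₂ n)))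
  where
  step₁ : ∀ n z → 2 * (n + z) + suc n ≡ 2 * z + n + (2 * n + 1)
  step₁ = solve-∀
  step₂ : ∀ n → n * n + (2 * n + 1) ≡ suc n * suc n
  step₂ = solve-∀

sum-map-const : ∀ {A : Set} (c : ℕ) (xs : List A) → ListAction.sum (map (λ _ → c) xs) ≡ length xs * c
sum-map-const c []       = refl
sum-map-const c (x ∷ xs) = cong (c +_) (sum-map-const c xs)

-- Leaves of forests

module _ {m : ℕ} (H : Graph m) where

  module _ (f : ℕ → Fin m) (f-adj : ∀ i → Adj H (f i) (f (suc i))) (f-nonback : ∀ i → f (2 + i) ≢ f i) where

    -- A closed stretch of the walk with no shorter closed stretch inside it is a cycle.
    closed⇒cycle : ∀ g i → f i ≡ f (i + suc g) → Cycle H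
    closed⇒cycle = <-rec _ step
      where
      step : ∀ g → (∀ {h} → h < g → ∀ i → f i ≡ f (i + suc h) → Cycle H) → ∀ i → f i ≡ f (i + suc g) → Cycle H
      -- A closed stretch of length 1 would be a loop and one of length 2 a backtrack; from length 3
      -- on, the stretch is long enough for a cycle.
      step zero _ i eq rewrite +-comm i 1 = contradiction (subst (Adj H (f i)) (sym eq) (f-adj i)) (irref H)
      step (suc zero) _ i eq rewrite +-comm i 2 = contradiction (sym eq) (f-nonback i)
      step (suc (suc g)) rec i eq
        with any? (λ (a : Fin (3 + g)) → any? (λ (b : Fin (3 + g)) → (toℕ a <? toℕ b) ×-dec (f (i + toℕ a) ≟ f (i + toℕ b))))
      ... | yes (a , b , a<b , fa≡fb) with o , e ← m≤n⇒∃[o]m+o≡n a<b =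
        rec {o} o<2+g (i + toℕ a)
          (trans fa≡fb (cong f (trans (cong (i +_) (sym a+o≡b)) (sym (+-assoc i (toℕ a) (suc o))))))
        where
        a+o≡b : toℕ a + suc o ≡ toℕ b
        a+o≡b = trans (+-suc (toℕ a) o) e
        o<2+g : o < 2 + g
        o<2+g = s≤s⁻¹ (≤-<-trans (subst (suc o ≤_) a+o≡b (m≤n+m (suc o) (toℕ a))) (toℕ<n b))
      ... | no distinct = record
        { len = g
        ; w = λ a → f (i + toℕ a)
        ; w-inj = λ {a} {b} → inj a b
        ; w-adj = λ a b b≡1+a → subst (λ j → Adj H (f (i + toℕ a)) (f j)) (sym (trans (cong (i +_) b≡1+a) (+-suc i (toℕ a)))) (f-adj (i + toℕ a))
        ; w-close = close
        }
        where
        inj : ∀ a b → f (i + toℕ a) ≡ f (i + toℕ b) → a ≡ b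
        inj a b fa≡fb with <-cmp (toℕ a) (toℕ b)
        ... | tri< a<b _ _ = contradiction (a , b , a<b , fa≡fb) distinct
        ... | tri≈ _ a≡b _ = toℕ-injective a≡b
        ... | tri> _ _ b<a = contradiction (b , a , b<a , sym fa≡fb) distinct
        close : ∀ a b → toℕ a ≡ 2 + g → toℕ b ≡ 0 → Adj H (f (i + toℕ a)) (f (i + toℕ b))
        close a b a≡ b≡ rewrite a≡ | b≡ | +-identityʳ i =
          subst (Adj H (f (i + (2 + g)))) (sym (trans eq (cong f (+-suc i (2 + g))))) (f-adj (i + (2 + g)))

    -- Two of the first m + 1 positions carry the same vertex, which closes a stretch.
    nonbacktracking⇒cycle : Cycle H
    nonbacktracking⇒cycle with a , b , a<b , fa≡fb ← pigeonhole (n<1+n m) (λ a → f (toℕ a))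
      with o , e ← m≤n⇒∃[o]m+o≡n a<b =
      closed⇒cycle o (toℕ a) (trans fa≡fb (cong f (trans (sym e) (sym (+-suc (toℕ a) o)))))

  -- u is only a candidate: it need not lie in S, and then v is isolated in S.
  LeafAt : List (Fin m) → Fin m → Fin m → Set
  LeafAt S v u = ∀ w → w ∈ S → Adj H v w → w ≡ u

  leafAt? : (∀ u v → Dec (Adj H u v)) → ∀ S v u → Dec (LeafAt S v u)
  leafAt? adj? S v u = map′ (λ all w w∈S → All.lookup all w∈S) (λ leaf → All.tabulate (λ {w} → leaf w))
                         (All.all? (λ w → adj? v w →-dec (w ≟ u)) S)

  -- Otherwise each vertex of `S` has, for any prescribed `u`, a neighbour in `S` other than `u`.
  -- Taking `u` to be the previous vertex continues a walk forever without backtracking, which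
  -- forces a cycle.
  forest⇒leaf : Forest H → (∀ u v → Dec (Adj H u v)) → ∀ S {v} → v ∈ S → ∃[ v ] v ∈ S × ∃[ u ] LeafAt S v u
  forest⇒leaf forest adj? S {v₀} v₀∈S
    with Any.any? (λ v → any? (λ u → leafAt? adj? S v u)) S
  ... | yes any with v , v∈S , u , leaf ← find any = v , v∈S , u , leaf
  ... | no noLeaf = contradiction (nonbacktracking⇒cycle (proj₁ ∘ cur ∘ walk) walk-adj walk-nonback) forest
    where
    V : Set
    V = ∃[ v ] v ∈ S

    next : (v : V) (u : Fin m) → ∃[ w ] w ∈ S × Adj H (proj₁ v) w × w ≢ u
    next (v , v∈S) u with Any.any? (λ w → adj? v w ×-dec ¬? (w ≟ u)) S
    ... | yes any = find any
    ... | no none = contradiction (lose v∈S (u , λ w w∈S vw → decidable-stable (w ≟ u) (λ w≢u → none (lose w∈S (vw , w≢u))))) noLeaf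

    State : Set
    State = Fin m × V
    cur : State → V
    cur = proj₂
    advance : State → State
    advance (u , v) with w , w∈S , _ ← next v u = proj₁ v , (w , w∈S)

    walk : ℕ → State
    -- The start is its own predecessor, a constraint that every neighbour meets because `H` has no
    -- loops.
    walk zero    = v₀ , (v₀ , v₀∈S)
    walk (suc i) = advance (walk i)

    walk-adj : ∀ i → Adj H (proj₁ (cur (walk i))) (proj₁ (cur (walk (suc i))))
    walk-adj i = proj₁ (proj₂ (proj₂ (next (cur (walk i)) (proj₁ (walk i)))))

    walk-nonback : ∀ i → proj₁ (cur (walk (2 + i))) ≢ proj₁ (cur (walk i))
    walk-nonback i = proj₂ (proj₂ (proj₂ (next (cur (walk (suc i))) (proj₁ (walk (suc i))))))

-- Levels and the greedy embedding

-- If every scaled value fell short of `n`, strictness would gain one unit per index, and the sum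
-- over all indices would contradict `n ≤ ∑ g`.
∃-average : ∀ {m n} (g : Fin m → ℕ) → 0 < n → n ≤ ∑ g → ∃[ d ] n ≤ m * g d
∃-average {zero}  g 0<n n≤0 = contradiction (<-≤-trans 0<n n≤0) λ ()
∃-average {suc m} {n} g 0<n n≤∑ with any? (λ d → n ≤? suc m * g d)
... | yes found = found
... | no none = contradiction too-small (<⇒≱ (m<n+m (suc m * n) {suc m} (s≤s z≤n)))
  where
  open ≤-Reasoning
  too-small : suc m + suc m * n ≤ suc m * n
  too-small = begin
    suc m + suc m * n                ≤⟨ +-monoʳ-≤ (suc m) (*-monoʳ-≤ (suc m) n≤∑) ⟩
    suc m + suc m * ∑ g              ≡⟨ cong₂ _+_ (sym (trans (∑-const (suc m) 1) (*-identityʳ (suc m)))) (*-distribˡ-sum (suc m) g) ⟩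
    ∑[ d < suc m ] 1 + ∑[ d < suc m ] (suc m * g d) ≡⟨ ∑-distrib-+ (λ (_ : Fin (suc m)) → 1) (λ d → suc m * g d) ⟨
    ∑[ d < suc m ] (1 + suc m * g d) ≤⟨ ∑-mono-≤ {g = λ _ → n} (λ d → ≰⇒> (none ∘ (d ,_))) ⟩
    ∑[ d < suc m ] n                 ≡⟨ ∑-const (suc m) n ⟩
    suc m * n ∎

-- With `b` recording membership in successive sets, a point of the first set either leaves at some
-- step before `D` or is still present at `D`.
𝟙-telescope : ∀ (b : ℕ → Bool) D → 𝟙 (b 0) ≤ ∑[ d < D ] 𝟙 (b (toℕ d) ∧ not (b (suc (toℕ d)))) + 𝟙 (b D)
𝟙-telescope b zero    = ≤-refl
𝟙-telescope b (suc D) = begin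
  𝟙 (b 0)                                  ≤⟨ drop (b 0) (b 1) ⟩
  𝟙 (b 0 ∧ not (b 1)) + 𝟙 (b 1)            ≤⟨ +-monoʳ-≤ _ (𝟙-telescope (b ∘ suc) D) ⟩
  𝟙 (b 0 ∧ not (b 1)) + (∑[ d < D ] 𝟙 (b (suc (toℕ d)) ∧ not (b (2 + toℕ d))) + 𝟙 (b (suc D)))
    ≡⟨ +-assoc (𝟙 (b 0 ∧ not (b 1))) _ _ ⟨
  ∑[ d < suc D ] 𝟙 (b (toℕ d) ∧ not (b (suc (toℕ d)))) + 𝟙 (b (suc D)) ∎
  where
  open ≤-Reasoning
  drop : ∀ p q → 𝟙 p ≤ 𝟙 (p ∧ not q) + 𝟙 q
  drop false _     = z≤n
  drop true  true  = ≤-refl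
  drop true  false = ≤-refl

T-∧⁻ : ∀ {p q} → T (p ∧ q) → T p × T q
T-∧⁻ = Equivalence.to T-∧

T-∧⁺ : ∀ {p q} → T p → T q → T (p ∧ q)
T-∧⁺ p q = Equivalence.from T-∧ (p , q)

T-not⁻ : ∀ {p} → T (not p) → ¬ T p
T-not⁻ {false} _ ()

≤ᵇ-mono : ∀ {t p q} → p ≤ q → T (t ≤ᵇ p) → T (t ≤ᵇ q)
≤ᵇ-mono {t} {p} p≤q t≤p = ≤⇒≤ᵇ (≤-trans (≤ᵇ⇒≤ t p t≤p) p≤q)

module Levels {n k : ℕ} (c : Colouring n k) (t : ℕ) where

  -- The diagonal term y = x is counted with its arbitrary colour. This does not harm the embedding:
  -- whenever an edge from `x` is wanted there, `x` is already an image and hence excluded.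
  degree : (Fin n → Bool) → Fin n → Fin k → ℕ
  degree S x i = count (λ y → S y ∧ ⌊ col c x y ≟ i ⌋)

  frequent : (Fin n → Bool) → Fin n → Fin k → Bool
  frequent S x i = t ≤ᵇ degree S x i

  rich : (Fin n → Bool) → Fin n → Bool
  rich S x = t ≤ᵇ count (frequent S x)

  level : ℕ → Fin n → Bool
  level zero    x = true
  level (suc d) x = rich (level d) x

  frequent-mono : ∀ {S S′} → (∀ x → T (S x) → T (S′ x)) → ∀ x i → T (frequent S x i) → T (frequent S′ x i)
  frequent-mono S⊆S′ x i = ≤ᵇ-mono {t} (count-mono λ y Sy → let (s , e) = T-∧⁻ Sy in T-∧⁺ (S⊆S′ y s) e)

  rich-mono : ∀ {S S′} → (∀ x → T (S x) → T (S′ x)) → ∀ x → T (rich S x) → T (rich S′ x)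
  rich-mono S⊆S′ x = ≤ᵇ-mono {t} (count-mono (frequent-mono S⊆S′ x))

  level-pred : ∀ d x → T (level (suc d) x) → T (level d x)
  level-pred zero    x _ = _
  level-pred (suc d) x = rich-mono (level-pred d) x

  level-antitone : ∀ s d x → T (level (s + d) x) → T (level d x)
  level-antitone zero    d x = id
  level-antitone (suc s) d x = level-antitone s d x ∘ level-pred (s + d) x

  -- Two greedy choices: at least `t` frequent colours against fewer than `t` forbidden ones, then
  -- at least `t` neighbours in that colour against fewer than `t` forbidden vertices.
  rich⇒fresh : ∀ {S x} → T (rich S x) → ∀ (is : List (Fin k)) (ys : List (Fin n)) → length is < t → length ys < t →
               ∃[ y ] T (S y) × y ∉ ys × col c x y ∉ is
  rich⇒fresh {S} {x} r is ys is<t ys<t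
    with i , freq , i∉is ← count>length⇒∃∉ (frequent S x) is (<-≤-trans is<t (≤ᵇ⇒≤ t _ r))
    with y , Sy , y∉ys ← count>length⇒∃∉ _ ys (<-≤-trans ys<t (≤ᵇ⇒≤ t _ freq))
    with s , xy ← T-∧⁻ {S y} Sy
    with refl ← toWitness {a? = col c x y ≟ i} xy = y , s , y∉ys , i∉is

  module _ (M : ℕ) .{{_ : NonZero t}} (L : Fin n → Bool)
    (poor : ∀ x → T (L x) → ¬ T (rich L x))
    (colour-few : ∀ i → ∑[ x < n ] ∑[ y < n ] 𝟙≡ (col c x y) i ≤ M)
    where

    private
      module LC = LocalColouring t M (𝟙 ∘ L) (λ x y → 𝟙≡ (col c x y)) (λ x i → 𝟙 (frequent L x i))
        (𝟙-01 ∘ L) (λ x y → ∑-𝟙≡ (col c x y)) (λ x y i → 𝟙≤1 _) (λ x y i → cong (λ z → 𝟙≡ z i) (csym c x y))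

      degree≡d : ∀ x i → degree L x i ≡ LC.d x i
      degree≡d x i = sum-cong-≗ (λ y → 𝟙-∧ (L y) _)

      f-01 : ∀ x i → 𝟙 (frequent L x i) ≡ 1 ⊎ (𝟙 (frequent L x i) ≡ 0 × LC.d x i ≤ t)
      f-01 x i with frequent L x i in eq
      ... | true  = inj₁ refl
      ... | false = inj₂ (refl , subst (_≤ t) (degree≡d x i) (<⇒≤ (≰⇒> (λ t≤ → subst T eq (≤⇒≤ᵇ t≤)))))

      f-few : ∀ x → 𝟙 (L x) ≡ 1 → count (frequent L x) ≤ t
      f-few x Lx with L x in eq
      ... | true = <⇒≤ (≰⇒> (λ t≤ → poor x (subst T (sym eq) _) (≤⇒≤ᵇ t≤)))

      few : ∀ i → ∑[ x < n ] (𝟙 (L x) * LC.d x i) ≤ M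
      few i = ≤-trans (∑-mono-≤ (λ x → ≤-trans (scale (𝟙≤1 (L x))) (∑-mono-≤ (λ y → scale (𝟙≤1 (L y)))))) (colour-few i)
        where
        scale : ∀ {p q} → p ≤ 1 → p * q ≤ q
        scale {p} {q} p≤1 = ≤-trans (*-monoˡ-≤ q p≤1) (≤-reflexive (*-identityˡ q))

    poor⇒small : count L * count L ≤ t * t * M + (t * t + 2 * t) * k * count L
    poor⇒small = LC.a²-bound f-01 f-few few

  level-gap : Fin t → Fin n → Bool
  level-gap d x = level (toℕ d) x ∧ not (level (suc (toℕ d)) x)

  -- Richness within the gap implies richness within `level d`, which would put `x` in the next
  -- level, outside the gap.
  level-gap-poor : ∀ d x → T (level-gap d x) → ¬ T (rich (level-gap d) x)
  level-gap-poor d x x∈ r = T-not⁻ (proj₂ (T-∧⁻ {level (toℕ d) x} x∈))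
    (rich-mono (λ y y∈ → proj₁ (T-∧⁻ y∈)) x r)

  -- By telescoping, every vertex leaves the levels at one of `t` steps, so the `t` gaps cover all
  -- vertices and one of them is at least average.
  level-empty⇒large-gap : 0 < n → (∀ x → ¬ T (level t x)) → ∃[ d ] n ≤ t * count (level-gap d)
  level-empty⇒large-gap 0<n empty = ∃-average (count ∘ level-gap) 0<n (begin
    n                                          ≡⟨ trans (∑-const n 1) (*-identityʳ n) ⟨
    ∑[ x < n ] 1                               ≤⟨ ∑-mono-≤ pointwise ⟩
    ∑[ x < n ] ∑[ d < t ] 𝟙 (level-gap d x)    ≡⟨ ∑-comm (λ x d → 𝟙 (level-gap d x)) ⟩
    ∑ (count ∘ level-gap) ∎)
    where
    open ≤-Reasoning
    pointwise : ∀ x → 1 ≤ ∑[ d < t ] 𝟙 (level-gap d x)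
    pointwise x with level t x | 𝟙-telescope (λ d → level d x) t | empty x
    ... | false | tele | _ = ≤-trans tele (≤-reflexive (+-identityʳ _))
    ... | true  | _    | ¬t = contradiction _ ¬t

  module _ (H : Graph t) (forest : Forest H) (adj? : ∀ u v → Dec (Adj H u v)) (x₀ : Fin n) (top : T (level t x₀)) where

    -- A partial rainbow copy on `S`; the values of `φ` outside `S` are arbitrary. Here `s` is the
    -- budget of vertices and colours spent, and `d` is the depth that the images retain for later
    -- extensions.
    record Embedding (S : List (Fin t)) (s d : ℕ) : Set where
      field
        φ       : Fin t → Fin n
        colours : List (Fin k)
        few     : length colours ≤ s
        deep    : ∀ {u} → u ∈ S → T (level d (φ u))
        inj     : ∀ {u v} → u ∈ S → v ∈ S → φ u ≡ φ v → u ≡ v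
        used    : ∀ {u v} → u ∈ S → v ∈ S → Adj H u v → col c (φ u) (φ v) ∈ colours
        rainbow : ∀ {u v u' v'} → u ∈ S → v ∈ S → u' ∈ S → v' ∈ S → Adj H u v → Adj H u' v' →
                  col c (φ u) (φ v) ≡ col c (φ u') (φ v') → (u ≡ u' × v ≡ v') ⊎ (u ≡ v' × v ≡ u')

    -- All edges from `v` into `S` go to `u`, so a single new colour suffices. The relation
    -- `s + suc d ≡ t` gives s < t, which keeps both forbidden lists short enough for `rich⇒fresh`.
    extend : ∀ {S s d v u} → length S ≤ s → s + suc d ≡ t → LeafAt H S v u → v ∉ S →
             Embedding S s (suc d) → Embedding (v ∷ S) (suc s) d
    extend {S} {s} {d} {v} {u} len s+d leaf v∉S E = record
      { φ = φ′
      ; colours = i ∷ E.colours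
      ; few = s≤s E.few
      ; deep = deep′
      ; inj = inj′
      ; used = λ a∈ b∈ ab → used′ (edge a∈ b∈ ab)
      ; rainbow = λ a∈ b∈ a'∈ b'∈ ab a'b' → rainbow′ (edge a∈ b∈ ab) (edge a'∈ b'∈ a'b')
      }
      where
      module E = Embedding E

      s<t : s < t
      s<t = subst (s <_) s+d (m<m+n s (s≤s z≤n))

      parent : ∃[ p ] T (level (suc d) p) × (u ∈ S → p ≡ E.φ u)
      parent with _∈?_ _≟_ u S
      ... | yes u∈S = E.φ u , E.deep u∈S , λ _ → refl
      -- Here `v` is isolated in `S`, so any vertex of the right level may act as parent; `x₀` lies
      -- in all levels up to `t`.
      ... | no  u∉S = x₀ , level-antitone s (suc d) x₀ (subst (λ z → T (level z x₀)) (sym s+d) top) , λ u∈S → contradiction u∈S u∉S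

      p : Fin n
      p = proj₁ parent

      fresh : ∃[ y ] T (level d y) × y ∉ map E.φ S × col c p y ∉ E.colours
      fresh = rich⇒fresh {level d} {p} (proj₁ (proj₂ parent)) E.colours (map E.φ S) (≤-<-trans E.few s<t)
                (≤-<-trans (subst (_≤ s) (sym (length-map E.φ S)) len) s<t)

      y : Fin n
      y = proj₁ fresh

      i : Fin k
      i = col c p y

      φ′ : Fin t → Fin n
      φ′ w with w ≟ v
      ... | yes _ = y
      ... | no  _ = E.φ w

      φ′-new : φ′ v ≡ y
      φ′-new with v ≟ v
      ... | yes _  = refl
      ... | no v≢v = contradiction refl v≢v

      φ′-old : ∀ {w} → w ∈ S → φ′ w ≡ E.φ w
      φ′-old {w} w∈S with w ≟ v
      ... | yes refl = contradiction w∈S v∉S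
      ... | no  _    = refl

      deep′ : ∀ {w} → w ∈ v ∷ S → T (level d (φ′ w))
      deep′ (here refl)  = subst (T ∘ level d) (sym φ′-new) (proj₁ (proj₂ fresh))
      deep′ (there w∈S) = subst (T ∘ level d) (sym (φ′-old w∈S)) (level-pred d _ (E.deep w∈S))

      φ′-new≢old : ∀ {w} → w ∈ S → φ′ v ≢ φ′ w
      φ′-new≢old w∈S eq = proj₁ (proj₂ (proj₂ fresh))
        (subst (_∈ map E.φ S) (trans (sym (φ′-old w∈S)) (trans (sym eq) φ′-new)) (∈-map⁺ E.φ w∈S))

      inj′ : ∀ {a b} → a ∈ v ∷ S → b ∈ v ∷ S → φ′ a ≡ φ′ b → a ≡ b
      inj′ (here refl) (here refl) _  = refl
      inj′ (here refl) (there b∈S) eq = contradiction eq (φ′-new≢old b∈S)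
      inj′ (there a∈S) (here refl) eq = contradiction (sym eq) (φ′-new≢old a∈S)
      inj′ (there a∈S) (there b∈S) eq = E.inj a∈S b∈S (trans (sym (φ′-old a∈S)) (trans eq (φ′-old b∈S)))

      -- Only the edge `uv`, in its two orientations, takes the fresh colour; every other edge
      -- inherits its colour. Rainbowness becomes a case check on pairs.
      data Edge (a b : Fin t) : Set where
        new  : a ≡ v → b ≡ u → col c (φ′ a) (φ′ b) ≡ i → Edge a b
        new˘ : a ≡ u → b ≡ v → col c (φ′ a) (φ′ b) ≡ i → Edge a b
        old  : a ∈ S → b ∈ S → Adj H a b → col c (φ′ a) (φ′ b) ≡ col c (E.φ a) (E.φ b) → Edge a b

      new-colour : u ∈ S → col c (φ′ u) (φ′ v) ≡ i
      new-colour u∈S = cong₂ (col c) (trans (φ′-old u∈S) (sym (proj₂ (proj₂ parent) u∈S))) φ′-new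

      edge : ∀ {a b} → a ∈ v ∷ S → b ∈ v ∷ S → Adj H a b → Edge a b
      edge (here refl) (here refl) ab = contradiction ab (irref H)
      edge (here refl) (there b∈S) ab with refl ← leaf _ b∈S ab =
        new refl refl (trans (csym c _ _) (new-colour b∈S))
      edge (there a∈S) (here refl) ab with refl ← leaf _ a∈S (adj-sym H ab) =
        new˘ refl refl (new-colour a∈S)
      edge (there a∈S) (there b∈S) ab = old a∈S b∈S ab (cong₂ (col c) (φ′-old a∈S) (φ′-old b∈S))

      used′ : ∀ {a b} → Edge a b → col c (φ′ a) (φ′ b) ∈ i ∷ E.colours
      used′ (new _ _ eq)  = here eq
      used′ (new˘ _ _ eq) = here eq
      used′ (old a∈S b∈S ab eq) = there (subst (_∈ E.colours) (sym eq) (E.used a∈S b∈S ab))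

      i-fresh : ∀ {a b} {z : Fin k} → a ∈ S → b ∈ S → Adj H a b → z ≡ i → z ≢ col c (E.φ a) (E.φ b)
      i-fresh a∈S b∈S ab z≡i eq = proj₂ (proj₂ (proj₂ fresh))
        (subst (_∈ E.colours) (trans (sym eq) z≡i) (E.used a∈S b∈S ab))

      rainbow′ : ∀ {a b a' b'} → Edge a b → Edge a' b' → col c (φ′ a) (φ′ b) ≡ col c (φ′ a') (φ′ b') →
                 (a ≡ a' × b ≡ b') ⊎ (a ≡ b' × b ≡ a')
      rainbow′ (new refl refl _)  (new refl refl _)  _ = inj₁ (refl , refl)
      rainbow′ (new refl refl _)  (new˘ refl refl _) _ = inj₂ (refl , refl)
      rainbow′ (new˘ refl refl _) (new refl refl _)  _ = inj₂ (refl , refl)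
      rainbow′ (new˘ refl refl _) (new˘ refl refl _) _ = inj₁ (refl , refl)
      rainbow′ (new _ _ z)  (old a∈ b∈ ab e) eq = contradiction (trans eq e) (i-fresh a∈ b∈ ab z)
      rainbow′ (new˘ _ _ z) (old a∈ b∈ ab e) eq = contradiction (trans eq e) (i-fresh a∈ b∈ ab z)
      rainbow′ (old a∈ b∈ ab e) (new _ _ z)  eq = contradiction (trans (sym eq) e) (i-fresh a∈ b∈ ab z)
      rainbow′ (old a∈ b∈ ab e) (new˘ _ _ z) eq = contradiction (trans (sym eq) e) (i-fresh a∈ b∈ ab z)
      rainbow′ (old a∈ b∈ ab e) (old a'∈ b'∈ a'b' e') eq = E.rainbow a∈ b∈ a'∈ b'∈ ab a'b' (trans (sym e) (trans eq e'))

    restrict : ∀ {S S′ s d} → (∀ {u} → u ∈ S′ → u ∈ S) → Embedding S s d → Embedding S′ s d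
    restrict S′⊆S E = record
      { φ = φ ; colours = colours ; few = few
      ; deep = λ u → deep (S′⊆S u)
      ; inj = λ u v → inj (S′⊆S u) (S′⊆S v)
      ; used = λ u v → used (S′⊆S u) (S′⊆S v)
      ; rainbow = λ u v u' v' → rainbow (S′⊆S u) (S′⊆S v) (S′⊆S u') (S′⊆S v')
      }
      where open Embedding E

    -- Removing a leaf trades one unit of `s` for one level of depth, so s + d = t persists; the
    -- leaf is put back one level below the vertices already placed.
    embed : ∀ s d S → s + d ≡ t → length S ≤ s → Embedding S s d
    embed s d [] _ _ = record
      { φ = λ _ → x₀ ; colours = [] ; few = z≤n
      ; deep = λ () ; inj = λ () ; used = λ () ; rainbow = λ () }
    embed (suc s) d S@(_ ∷ _) s+d len
      with v , v∈S , u , leaf ← forest⇒leaf H forest adj? S (here refl) =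
      restrict S⊆ (extend len′ s+d′ (λ w w∈ → leaf w (proj₁ (∈-filter⁻ ≢v? w∈))) (λ v∈ → proj₂ (∈-filter⁻ ≢v? {xs = S} v∈) refl)
        (embed s (suc d) (filter ≢v? S) s+d′ len′))
      where
      ≢v? : ∀ w → Dec (w ≢ v)
      ≢v? w = ¬? (w ≟ v)
      s+d′ : s + suc d ≡ t
      s+d′ = trans (+-suc s d) s+d
      len′ : length (filter ≢v? S) ≤ s
      len′ = s≤s⁻¹ (≤-trans (filter-notAll ≢v? S (lose v∈S (λ v≢v → v≢v refl))) len)
      S⊆ : ∀ {w} → w ∈ S → w ∈ v ∷ filter ≢v? S
      S⊆ {w} w∈S with w ≟ v
      ... | yes w≡v = here w≡v
      ... | no  w≢v = there (∈-filter⁺ ≢v? w∈S w≢v)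

    level-top⇒rainbow : RainbowCopy H c
    level-top⇒rainbow = φ , (λ {u} {v} → inj (∈-allFin u) (∈-allFin v))
                          , λ u v u' v' → rainbow (∈-allFin u) (∈-allFin v) (∈-allFin u') (∈-allFin v')
      where open Embedding (embed t 0 (allFin t) (+-identityʳ t) (≤-reflexive (length-tabulate id)))

-- The bound on n, and the equal distribution that violates it

-- Serves to assume that the `Set`-valued adjacency of `H` is decidable while a negation is being
-- proved.
¬¬-∀Fin : ∀ {n} {P : Fin n → Set} → (∀ i → ¬ ¬ P i) → ¬ ¬ (∀ i → P i)
¬¬-∀Fin {zero}  _   ¬∀ = ¬∀ λ ()
¬¬-∀Fin {suc n} ¬¬P ¬∀ = ¬¬P zero λ p₀ → ¬¬-∀Fin (¬¬P ∘ suc) λ ps → ¬∀ λ { zero → p₀ ; (suc i) → ps i }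

-- At k = m⁴ the quadratic terms balance.
threshold : ∀ m k n a M → m * m * (m * m) < k → n ≤ m * a → a ≤ n → k * M ≤ n * n + k * n →
  a * a ≤ m * m * M + (m * m + 2 * m) * k * a →
  n ≤ (m * m * (m * m) + m * m * (m * m + 2 * m) * k) * k
threshold m k zero a M _ _ _ _ _ = z≤n
threshold m k n@(suc _) a M m⁴<k n≤ma a≤n kM≤ a²≤ = *-cancelˡ-≤ n (+-cancelʳ-≤ (m * m * (m * m) * (n * n)) _ _ (begin
  -- The strict inequality `m⁴<k` supplies one spare n². After the m⁴n² on both sides is cancelled,
  -- this n² is bounded by a multiple of n.
  n * n + m * m * (m * m) * (n * n)                   ≤⟨ *-monoˡ-≤ (n * n) m⁴<k ⟩
  k * (n * n)                                         ≤⟨ *-monoʳ-≤ k (*-mono-≤ n≤ma n≤ma) ⟩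
  k * (m * a * (m * a))                               ≡⟨ eq₁ k m a ⟩
  k * (m * m) * (a * a)                               ≤⟨ *-monoʳ-≤ (k * (m * m)) a²≤ ⟩
  k * (m * m) * (m * m * M + (m * m + 2 * m) * k * a) ≡⟨ eq₂ k m a M ⟩
  m * m * (m * m) * (k * M) + m * m * (m * m + 2 * m) * k * k * a
    ≤⟨ +-mono-≤ (*-monoʳ-≤ (m * m * (m * m)) kM≤) (*-monoʳ-≤ (m * m * (m * m + 2 * m) * k * k) a≤n) ⟩
  m * m * (m * m) * (n * n + k * n) + m * m * (m * m + 2 * m) * k * k * n ≡⟨ eq₃ k m n ⟩
  n * ((m * m * (m * m) + m * m * (m * m + 2 * m) * k) * k) + m * m * (m * m) * (n * n) ∎))
  where
  open ≤-Reasoning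
  eq₁ : ∀ k m a → k * (m * a * (m * a)) ≡ k * (m * m) * (a * a)
  eq₁ = solve-∀
  eq₂ : ∀ k m a M → k * (m * m) * (m * m * M + (m * m + 2 * m) * k * a) ≡ m * m * (m * m) * (k * M) + m * m * (m * m + 2 * m) * k * k * a
  eq₂ = solve-∀
  eq₃ : ∀ k m n → m * m * (m * m) * (n * n + k * n) + m * m * (m * m + 2 * m) * k * k * n ≡ n * ((m * m * (m * m) + m * m * (m * m + 2 * m) * k) * k) + m * m * (m * m) * (n * n)
  eq₃ = solve-∀

-- A vertex in level `m` would yield a rainbow copy, so some gap is large, while being poor makes it
-- small. `M` bounds the ordered pairs of one colour, diagonal included.
rainbowFree⇒small : ∀ {m n k M} (H : Graph m) → Forest H → m * m * (m * m) < k → k * M ≤ n * n + k * n →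
  (c : Colouring n k) → (∀ i → 2 * colourCount c i + n ≤ M) → RainbowFree H c →
  n ≤ (m * m * (m * m) + m * m * (m * m + 2 * m) * k) * k
rainbowFree⇒small {n = zero} _ _ _ _ _ _ _ = z≤n
rainbowFree⇒small {m} {n@(suc _)} {k} {M} H forest m⁴<k kM≤ c few free =
  let d , n≤ma = level-empty⇒large-gap (s≤s z≤n) empty
      -- An index `d` below `m` shows that `m` is nonzero, as the cancellation in `poor⇒small`
      -- requires.
      instance _ = Finₚ.nonZeroIndex d
  in threshold m k n (count (level-gap d)) M m⁴<k n≤ma
       (≤-trans (∑-mono-≤ (λ x → 𝟙≤1 (level-gap d x))) (≤-reflexive (trans (∑-const n 1) (*-identityʳ n))))
       kM≤ (poor⇒small M (level-gap d) (level-gap-poor d) (λ i → ≤-trans (∑∑-colour≤ c i) (few i)))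
  where
  open Levels c m
  empty : ∀ x → ¬ T (level m x)
  empty x top = ¬¬-∀Fin (λ u → ¬¬-∀Fin (λ v → ¬¬-excluded-middle)) λ adj? →
    free (level-top⇒rainbow H forest adj? x top)

-- With n = 2kq the n(n - 1)/2 edges split exactly into `k` classes of size q(n - 1).
balanced : ∀ k n q r → n ≡ 2 * (k * q) → n ≡ suc r → k * (q * r) ≡ n C 2
balanced k n q r n≡2kq n≡1+r = *-cancelˡ-≡ _ _ 2 (+-cancelʳ-≡ n _ _ (trans lhs (sym (2*nC2+n≡n*n n))))
  where
  identity : ∀ k q r → 2 * (k * (q * r)) + 2 * (k * q) ≡ 2 * (k * q) * suc r
  identity = solve-∀
  lhs : 2 * (k * (q * r)) + n ≡ n * n
  lhs = trans (cong (2 * (k * (q * r)) +_) n≡2kq) (trans (identity k q r) (cong₂ _*_ (sym n≡2kq) (sym n≡1+r)))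

theorem1p7 : ∀ {m : ℕ} (H : Graph m) → Forest H → ∃[ K ] (∀ k → k ≥ K → GInfinite H k)
theorem1p7 {m} H forest = suc (m * m * (m * m)) , infinite
  where
  infinite : ∀ k → k ≥ suc (m * m * (m * m)) → GInfinite H k
  -- Matching `k` as a successor makes `n` compute to a successor, so that `n ≡ suc r` holds by
  -- `refl`.
  infinite k@(suc k′) m⁴<k (N , bound) =
    let c , dist , free = bound n (≤-trans (m≤n⇒m≤1+n (m≤m+n N B)) q≤n) (λ _ → q * r)
                            (trans (sum-map-const (q * r) (allFin k)) (trans (cong (_* (q * r)) (length-tabulate {n = k} id)) (balanced k n q r refl refl)))
    in contradiction (rainbowFree⇒small H forest m⁴<k kM≤ c (λ i → ≤-reflexive (cong (λ e → 2 * e + n) (dist i))) free)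
         (<⇒≱ (≤-trans (s≤s (m≤n+m B N)) q≤n))
    where
    -- `B` is the bound of `rainbowFree⇒small`, and `q` exceeds both `N` and `B`; the factor 2k in
    -- `n` serves `balanced`.
    B q r n : ℕ
    B = (m * m * (m * m) + m * m * (m * m + 2 * m) * k) * k
    q = suc (N + B)
    n = 2 * (k * q)
    r = pred n
    q≤n : q ≤ n
    q≤n = ≤-trans (m≤n*m q k) (m≤n*m (k * q) 2)
    open ≤-Reasoning
    identity : ∀ k e n → k * (2 * e + n) ≡ 2 * (k * e) + k * n
    identity = solve-∀
    kM≤ : k * (2 * (q * r) + n) ≤ n * n + k * n
    kM≤ = begin
      k * (2 * (q * r) + n)       ≡⟨ identity k (q * r) n ⟩
      2 * (k * (q * r)) + k * n   ≡⟨ cong (λ z → 2 * z + k * n) (balanced k n q r refl refl) ⟩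
      2 * (n C 2) + k * n         ≤⟨ +-monoˡ-≤ (k * n) (m≤m+n _ n) ⟩
      2 * (n C 2) + n + k * n     ≡⟨ cong (_+ k * n) (2*nC2+n≡n*n n) ⟩
      n * n + k * n ∎
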